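{- Let $M$ be a $\lambda\mu$-term with $rank(M)=k$. Then every $\beta\mu\rho\theta$-reduction sequence starting from $M$ has length less than $\mathrm{tower}(k+1,(2k+3)\cdot comp(M))$.
   Context: Terms are generated from $\lambda$-variables $x,y,\dots$ and $\mu$-variables $\alpha,\beta,\dots$ by $\mathcal T::=x\mid \lambda x.\mathcal T\mid\mu\alpha.\mathcal T\mid[\alpha]\mathcal T\mid(\mathcal T\,\mathcal T)$, modulo renaming of variables bound by $\lambda$ and $\mu$. $Fv(M)$ is the set of free variables of $M$. Complexity: $comp(x)=1$, $comp([\alpha]M)=comp(\lambda x.M)=comp(\mu\alpha.M)=comp(M)+1$, $comp(M\,N)=comp(M)+comp(N)$. Types are built from atomic types and the constant $\bot$ with $\to$; $\neg A$ is $A\to\bot$; $lh(A)$ is the number of arrows of $A$. A context $\Gamma$ is a finite set of declarations $x:A$ and $\alpha:\neg A$. Typing rules: $\Gamma,x:A\vdash x:A$; from $\Gamma,x:A\vdash M:B$ infer $\Gamma\vdash\lambda x.M:A\to B$; from $\Gamma\vdash M:A\to B$ and $\Gamma\vdash N:A$ infer $\Gamma\vdash M\,N:B$; from $\Gamma,\alpha:\neg A\vdash M:A$ infer $\Gamma,\alpha:\neg A\vdash[\alpha]M:\bot$; from $\Gamma,\alpha:\neg A\vdash M:\bot$ infer $\Gamma\vdash\mu\alpha.M:A$. All terms considered are typable ($\lambda\mu$-term means typable term), and types of subterms refer to a fixed typing derivation. Redexes and reduction rules: $(\lambda x.M)N\to_\beta M[x:=N]$; $(\mu\alpha.M)N\to_\mu\mu\alpha.M[\alpha:=_rN]$,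 where $M[\alpha:=_rN]$ is obtained by (recursively) replacing each subterm $[\alpha]U$ of $M$ ($\alpha$ free) by $[\alpha](U\,N)$; $[\alpha]\mu\beta.M\to_\rho M[\beta:=\alpha]$; $\mu\alpha.[\alpha]M\to_\theta M$ provided $\alpha\notin Fv(M)$. A $\beta\mu\rho\theta$-reduction step contracts one redex anywhere in a term. Rank of a redex $R$ in $M$: $lh(type(\lambda x.M_1))$ if $R=(\lambda x.M_1)M_2$; $lh(type(\mu\alpha.M_1))$ if $R=(\mu\alpha.M_1)M_2$; $lh(type(\mu\beta.M_1))$ if $R=[\alpha]\mu\beta.M_1$; $lh(type(\mu\alpha.[\alpha]M_1))$ if $R=\mu\alpha.[\alpha]M_1$ is a $\theta$-redex. $rank(M)$ is the maximum of the ranks of the redexes in $M$ (with $\max\emptyset=0$). $\mathrm{tower}(0,m)=m$ and $\mathrm{tower}(n,m)=2^{\mathrm{tower}(n-1,m)}$ for $n>0$. -}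

module Defs where

open import Data.Nat using (ℕ; zero; suc; _+_; _⊔_; _^_)
open import Data.Fin using (Fin; zero; suc; _≟_; lift)
open import Data.Fin.Properties using (suc-injective)
open import Data.Vec using (Vec; _∷_; lookup)
import Data.Vec.Functional as VF
open import Data.List using (List; []; [_]; _++_; foldr)
open import Data.Empty using (⊥)
open import Data.Sum using (_⊎_; inj₁; inj₂; [_,_]′)
open import Data.Product using (∃; _,_)
open import Function using (_∘_; id)
open import Function.Bundles using (_⇔_; mk⇔)
open import Relation.Nullary using (¬_; Dec; yes; no; contradiction)
open import Relation.Nullary.Decidable using (_⊎-dec_)
open import Relation.Binary.PropositionalEquality
  using (_≡_; _≢_; refl; sym; cong; cong₂)
open import Relation.Binary.Construct.Closure.ReflexiveTransitive
  using (Star; ε; _◅_)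

-- Terms up to renaming of bound variables, as well-scoped de Bruijn terms:
-- n bounds the free λ-variables and m the free μ-variables.
-- mu M is μα.M and named α M is [α]M.

data Tm : ℕ → ℕ → Set where
  var   : ∀ {n m} → Fin n → Tm n m
  lam   : ∀ {n m} → Tm (suc n) m → Tm n m
  mu    : ∀ {n m} → Tm n (suc m) → Tm n m
  named : ∀ {n m} → Fin m → Tm n m → Tm n m
  app   : ∀ {n m} → Tm n m → Tm n m → Tm n m

comp : ∀ {n m} → Tm n m → ℕ
comp (var x)     = 1
comp (lam M)     = comp M + 1
comp (mu M)      = comp M + 1
comp (named α M) = comp M + 1
comp (app M N)   = comp M + comp N

infix 4 _∈Fvμ_ _∈Fvμ?_

_∈Fvμ_ : ∀ {n m} → Fin m → Tm n m → Set
α ∈Fvμ var x     = ⊥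
α ∈Fvμ lam M     = α ∈Fvμ M
α ∈Fvμ mu M      = suc α ∈Fvμ M
α ∈Fvμ named β M = α ≡ β ⊎ α ∈Fvμ M
α ∈Fvμ app M N   = α ∈Fvμ M ⊎ α ∈Fvμ N

_∈Fvμ?_ : ∀ {n m} (α : Fin m) (M : Tm n m) → Dec (α ∈Fvμ M)
α ∈Fvμ? var x     = no λ ()
α ∈Fvμ? lam M     = α ∈Fvμ? M
α ∈Fvμ? mu M      = suc α ∈Fvμ? M
α ∈Fvμ? named β M = (α ≟ β) ⊎-dec (α ∈Fvμ? M)
α ∈Fvμ? app M N   = (α ∈Fvμ? M) ⊎-dec (α ∈Fvμ? N)

renameλ : ∀ {n n′ m} → (Fin n → Fin n′) → Tm n m → Tm n′ m
renameλ ρ (var x)     = var (ρ x)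
renameλ ρ (lam M)     = lam (renameλ (lift 1 ρ) M)
renameλ ρ (mu M)      = mu (renameλ ρ M)
renameλ ρ (named α M) = named α (renameλ ρ M)
renameλ ρ (app M N)   = app (renameλ ρ M) (renameλ ρ N)

renameμ : ∀ {n m m′} → (Fin m → Fin m′) → Tm n m → Tm n m′
renameμ ρ (var x)     = var x
renameμ ρ (lam M)     = lam (renameμ ρ M)
renameμ ρ (mu M)      = mu (renameμ (lift 1 ρ) M)
renameμ ρ (named α M) = named (ρ α) (renameμ ρ M)
renameμ ρ (app M N)   = app (renameμ ρ M) (renameμ ρ N)

weakenλ : ∀ {n m} → Tm n m → Tm (suc n) m
weakenλ = renameλ suc

weakenμ : ∀ {n m} → Tm n m → Tm n (suc m)
weakenμ = renameμ suc

substλ : ∀ {n n′ m} → (Fin n → Tm n′ m) → Tm n m → Tm n′ m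
substλ σ (var x)     = σ x
substλ σ (lam M)     = lam (substλ (var zero VF.∷ weakenλ ∘ σ) M)
substλ σ (mu M)      = mu (substλ (weakenμ ∘ σ) M)
substλ σ (named α M) = named α (substλ σ M)
substλ σ (app M N)   = app (substλ σ M) (substλ σ N)

infix 8 _[≔_] _[≔μ_] _[_≔r_]

-- M[x := N] for the outermost λ-variable x of M.
_[≔_] : ∀ {n m} → Tm (suc n) m → Tm n m → Tm n m
M [≔ N ] = substλ (N VF.∷ var) M

-- M[β := α] for the outermost μ-variable β of M.
_[≔μ_] : ∀ {n m} → Tm n (suc m) → Fin m → Tm n m
M [≔μ α ] = renameμ (α VF.∷ id) M

-- M[α :=r N].  The variable α stays in scope.
_[_≔r_] : ∀ {n m} → Tm n m → Fin m → Tm n m → Tm n m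
var x     [ α ≔r N ] = var x
lam M     [ α ≔r N ] = lam (M [ α ≔r weakenλ N ])
mu M      [ α ≔r N ] = mu (M [ suc α ≔r weakenμ N ])
named β M [ α ≔r N ] with α ≟ β
... | yes _ = named β (app (M [ α ≔r N ]) N)
... | no  _ = named β (M [ α ≔r N ])
app M P   [ α ≔r N ] = app (M [ α ≔r N ]) (P [ α ≔r N ])

infix 4 _⟶_ _⟶*_

-- In θ-red, the side condition α ∉ Fv(M) is expressed by the body being a
-- weakening; see ∉Fvμ⇔weakenμ below.
data _⟶_ : ∀ {n m} → Tm n m → Tm n m → Set where
  β-red : ∀ {n m} {M : Tm (suc n) m} {N : Tm n m} →
          app (lam M) N ⟶ M [≔ N ]
  μ-red : ∀ {n m} {M : Tm n (suc m)} {N : Tm n m} →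
          app (mu M) N ⟶ mu (M [ zero ≔r weakenμ N ])
  ρ-red : ∀ {n m} {α : Fin m} {M : Tm n (suc m)} →
          named α (mu M) ⟶ M [≔μ α ]
  θ-red : ∀ {n m} {M : Tm n m} →
          mu (named zero (weakenμ M)) ⟶ M
  ξ-lam   : ∀ {n m} {M M′ : Tm (suc n) m} → M ⟶ M′ → lam M ⟶ lam M′
  ξ-mu    : ∀ {n m} {M M′ : Tm n (suc m)} → M ⟶ M′ → mu M ⟶ mu M′
  ξ-named : ∀ {n m} {α : Fin m} {M M′ : Tm n m} →
            M ⟶ M′ → named α M ⟶ named α M′
  ξ-appˡ  : ∀ {n m} {M M′ N : Tm n m} → M ⟶ M′ → app M N ⟶ app M′ N
  ξ-appʳ  : ∀ {n m} {M N N′ : Tm n m} → N ⟶ N′ → app M N ⟶ app M N′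

_⟶*_ : ∀ {n m} → Tm n m → Tm n m → Set
_⟶*_ = Star _⟶_

length : ∀ {n m} {M N : Tm n m} → M ⟶* N → ℕ
length ε        = 0
length (_ ◅ rs) = suc (length rs)

infixr 7 _⇒_

data Ty : Set where
  atom : ℕ → Ty
  ⊥̇    : Ty
  _⇒_  : Ty → Ty → Ty

lh : Ty → ℕ
lh (atom _) = 0
lh ⊥̇        = 0
lh (A ⇒ B)  = lh A + lh B + 1

infix 3 _︔_⊢_∶_

-- Γ holds the declarations x : A.  Δ holds those of μ-variables, an entry A
-- of Δ standing for the declaration α : ¬A.
data _︔_⊢_∶_ : ∀ {n m} → Vec Ty n → Vec Ty m → Tm n m → Ty → Set where
  ⊢var   : ∀ {n m} {Γ : Vec Ty n} {Δ : Vec Ty m} {x A} →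
           lookup Γ x ≡ A → Γ ︔ Δ ⊢ var x ∶ A
  ⊢lam   : ∀ {n m} {Γ : Vec Ty n} {Δ : Vec Ty m} {M A B} →
           A ∷ Γ ︔ Δ ⊢ M ∶ B → Γ ︔ Δ ⊢ lam M ∶ A ⇒ B
  ⊢app   : ∀ {n m} {Γ : Vec Ty n} {Δ : Vec Ty m} {M N A B} →
           Γ ︔ Δ ⊢ M ∶ A ⇒ B → Γ ︔ Δ ⊢ N ∶ A → Γ ︔ Δ ⊢ app M N ∶ B
  ⊢named : ∀ {n m} {Γ : Vec Ty n} {Δ : Vec Ty m} {α M A} →
           lookup Δ α ≡ A → Γ ︔ Δ ⊢ M ∶ A → Γ ︔ Δ ⊢ named α M ∶ ⊥̇
  ⊢mu    : ∀ {n m} {Γ : Vec Ty n} {Δ : Vec Ty m} {M A} →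
           Γ ︔ A ∷ Δ ⊢ M ∶ ⊥̇ → Γ ︔ Δ ⊢ mu M ∶ A

-- The rank of the subject as a redex, or [] if it is not itself a redex.
rootRank : ∀ {n m} {Γ : Vec Ty n} {Δ : Vec Ty m} {M A} →
           Γ ︔ Δ ⊢ M ∶ A → List ℕ
rootRank (⊢app {A = A} {B = B} (⊢lam _) _) = [ lh (A ⇒ B) ]
rootRank (⊢app {A = A} {B = B} (⊢mu _) _)  = [ lh (A ⇒ B) ]
rootRank (⊢named {A = A} _ (⊢mu _))        = [ lh A ]
rootRank (⊢mu {A = A} (⊢named {α = zero} {M = M} _ _)) with zero ∈Fvμ? M
... | yes _ = []
... | no  _ = [ lh A ]
rootRank _ = []

redexRanks : ∀ {n m} {Γ : Vec Ty n} {Δ : Vec Ty m} {M A} →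
             Γ ︔ Δ ⊢ M ∶ A → List ℕ
redexRanks d@(⊢var _)     = rootRank d
redexRanks d@(⊢lam e)     = rootRank d ++ redexRanks e
redexRanks d@(⊢app e f)   = rootRank d ++ redexRanks e ++ redexRanks f
redexRanks d@(⊢named _ e) = rootRank d ++ redexRanks e
redexRanks d@(⊢mu e)      = rootRank d ++ redexRanks e

-- The types of subterms, hence the rank, depend on the typing derivation.
rank : ∀ {n m} {Γ : Vec Ty n} {Δ : Vec Ty m} {M A} →
       Γ ︔ Δ ⊢ M ∶ A → ℕ
rank d = foldr _⊔_ 0 (redexRanks d)

tower : ℕ → ℕ → ℕ
tower zero    m = m
tower (suc n) m = 2 ^ tower n m

private
  ∉Fvμ⇒renameμ : ∀ {n m m′} (ρ : Fin m′ → Fin m) (α : Fin m) →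
                 (∀ β → α ≢ β → ∃ λ γ → ρ γ ≡ β) →
                 (M : Tm n m) → ¬ α ∈Fvμ M → ∃ λ M′ → M ≡ renameμ ρ M′
  ∉Fvμ⇒renameμ ρ α h (var x) _ = var x , refl
  ∉Fvμ⇒renameμ ρ α h (lam M) α∉ with ∉Fvμ⇒renameμ ρ α h M α∉
  ... | M′ , eq = lam M′ , cong lam eq
  ∉Fvμ⇒renameμ ρ α h (mu M) α∉ with ∉Fvμ⇒renameμ (lift 1 ρ) (suc α) h′ M α∉
    where
    h′ : ∀ β → suc α ≢ β → ∃ λ γ → lift 1 ρ γ ≡ β
    h′ zero    _  = zero , refl
    h′ (suc β) ne with h β (ne ∘ cong suc)
    ... | γ , eq = suc γ , cong suc eq
  ... | M′ , eq = mu M′ , cong mu eq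
  ∉Fvμ⇒renameμ ρ α h (named β M) α∉
    with h β (α∉ ∘ inj₁) | ∉Fvμ⇒renameμ ρ α h M (α∉ ∘ inj₂)
  ... | γ , eq | M′ , eq′ = named γ M′ , cong₂ named (sym eq) eq′
  ∉Fvμ⇒renameμ ρ α h (app M N) α∉
    with ∉Fvμ⇒renameμ ρ α h M (α∉ ∘ inj₁) | ∉Fvμ⇒renameμ ρ α h N (α∉ ∘ inj₂)
  ... | M′ , eq | N′ , eq′ = app M′ N′ , cong₂ app eq eq′

  renameμ⇒∉Fvμ : ∀ {n m m′} (ρ : Fin m′ → Fin m) (α : Fin m) →
                 (∀ γ → α ≢ ρ γ) → (M : Tm n m′) → ¬ α ∈Fvμ renameμ ρ M
  renameμ⇒∉Fvμ ρ α h (lam M)     = renameμ⇒∉Fvμ ρ α h M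
  renameμ⇒∉Fvμ ρ α h (mu M)      = renameμ⇒∉Fvμ (lift 1 ρ) (suc α) h′ M
    where
    h′ : ∀ γ → suc α ≢ lift 1 ρ γ
    h′ (suc γ) eq = h γ (suc-injective eq)
  renameμ⇒∉Fvμ ρ α h (named β M) = [ h β , renameμ⇒∉Fvμ ρ α h M ]′
  renameμ⇒∉Fvμ ρ α h (app M N)   =
    [ renameμ⇒∉Fvμ ρ α h M , renameμ⇒∉Fvμ ρ α h N ]′

∉Fvμ⇔weakenμ : ∀ {n m} {M : Tm n (suc m)} →
               (¬ zero ∈Fvμ M) ⇔ (∃ λ M′ → M ≡ weakenμ M′)
∉Fvμ⇔weakenμ {n} {m} {M} = mk⇔ (∉Fvμ⇒renameμ suc zero h M) from
  where
  h : ∀ (β : Fin (suc m)) → zero ≢ β → ∃ λ γ → suc γ ≡ β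
  h zero    ne = contradiction refl ne
  h (suc β) _  = β , refl
  from : (∃ λ M′ → M ≡ weakenμ M′) → ¬ zero ∈Fvμ M
  from (M′ , refl) = renameμ⇒∉Fvμ suc zero (λ _ ()) M′

{-# OPTIONS --safe #-}
module Submission where

-- The argument assigns to a typing derivation a tree with cuts, in the style of
-- Schwichtenberg and Beckmann.  In such a tree an application is neutral
-- (headed by a variable), or a cut whose operator has a type of bounded length,
-- or it is derived from its head contractum and the argument consumed by that
-- contraction, so that erased arguments are accounted for.  A tree without cuts
-- of height a bounds all reduction sequences by 2 ^ a: the bound for a head
-- redex is the sum of those for the contractum and the argument, while ρ and θ
-- only cost one step for each [α] or μ.  Substituting a tree of height b at a
-- cut turns height a into at most 2a + b, so lowering the cut rank by one takes
-- height a to 4 ^ a; one starts from height comp M and cut rank k.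

open import Defs
open import Data.Nat
  using (ℕ; zero; suc; _+_; _*_; _<_; _≤_; _^_; _⊔_; z≤n; s≤s; s≤s⁻¹; >-nonZero)
open import Data.Nat.Properties hiding (_≟_)
open import Data.Nat.Solver using (module +-*-Solver)
open import Data.Fin using (Fin; zero; suc; lift; _≟_)
open import Data.Vec using (Vec; _∷_; lookup)
import Data.Vec.Functional as VF
open import Data.List using (List; []; _∷_; [_]; _++_; map; foldl; foldr)
open import Data.List.Properties
  using (map-cong; map-∘; map-id; map-++; ++-identityʳ; foldl-++; ++-assoc)
open import Data.Product using (_×_; ∃; _,_; proj₁; proj₂)
open import Data.Sum using (_⊎_; inj₁; inj₂)
open import Data.Unit using (⊤; tt)
open import Function using (_∘_; id)
open import Function.Bundles using (Equivalence)
open import Relation.Nullary using (¬_; yes; no; contradiction)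
open import Relation.Binary.PropositionalEquality
  using (_≡_; refl; sym; trans; cong; cong₂; subst; subst₂; module ≡-Reasoning)
open import Relation.Binary.Construct.Closure.ReflexiveTransitive
  using (ε; _◅_; _◅◅_; gmap)

open +-*-Solver using (solve; _:+_; _:*_; con; _:=_)

private variable
  n m n′ m′ n″ m″ : ℕ

-- Simultaneous substitutions

apps : Tm n m → List (Tm n m) → Tm n m
apps = foldl app

-- A μ-variable α is sent to a name together with a list of arguments, so that
-- [α]M becomes [name α](M′ L₁ … Lₖ).  Lists make these substitutions closed
-- under composition.
record Sub (n m n′ m′ : ℕ) : Set where
  constructor mkSub
  field
    term : Fin n → Tm n′ m′
    name : Fin m → Fin m′
    args : Fin m → List (Tm n′ m′)

open Sub

liftλ : Sub n m n′ m′ → Sub (suc n) m (suc n′) m′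
liftλ s = mkSub (var zero VF.∷ weakenλ ∘ term s) (name s) (map weakenλ ∘ args s)

-- `Ls` is attached to the bound name; this describes the body of a `mu` that has absorbed the
-- arguments `Ls` by μ-contractions.
liftμ-push : Sub n m n′ m′ → List (Tm n′ m′) → Sub n (suc m) n′ (suc m′)
liftμ-push s Ls = mkSub (weakenμ ∘ term s) (lift 1 (name s))
  (map weakenμ Ls VF.∷ map weakenμ ∘ args s)

liftμ : Sub n m n′ m′ → Sub n (suc m) n′ (suc m′)
liftμ s = liftμ-push s []

sub : Sub n m n′ m′ → Tm n m → Tm n′ m′
sub s (var x)     = term s x
sub s (lam M)     = lam (sub (liftλ s) M)
sub s (mu M)      = mu (sub (liftμ s) M)
sub s (named α M) = named (name s α) (apps (sub s M) (args s α))
sub s (app M N)   = app (sub s M) (sub s N)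

renSub : (Fin n → Fin n′) → (Fin m → Fin m′) → Sub n m n′ m′
renSub ρ π = mkSub (var ∘ ρ) π (λ _ → [])

consλ : Tm n′ m′ → Sub n m n′ m′ → Sub (suc n) m n′ m′
consλ N s = mkSub (N VF.∷ term s) (name s) (args s)

consμ : Fin m′ → List (Tm n′ m′) → Sub n m n′ m′ → Sub n (suc m) n′ m′
consμ α Ls s = mkSub (term s) (α VF.∷ name s) (Ls VF.∷ args s)

infixr 9 _⨾_
-- `s` acts first, so its arguments, once substituted, stay closer to the named term than those
-- added by `t`.
_⨾_ : Sub n m n′ m′ → Sub n′ m′ n″ m″ → Sub n m n″ m″
s ⨾ t = mkSub (sub t ∘ term s) (name t ∘ name s)
  (λ α → map (sub t) (args s α) ++ args t (name s α))

infix 4 _≈_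
record _≈_ (s t : Sub n m n′ m′) : Set where
  constructor mk≈
  field
    term≡ : ∀ x → term s x ≡ term t x
    name≡ : ∀ α → name s α ≡ name t α
    args≡ : ∀ α → args s α ≡ args t α

open _≈_

≈-sym : {s t : Sub n m n′ m′} → s ≈ t → t ≈ s
≈-sym e = mk≈ (sym ∘ term≡ e) (sym ∘ name≡ e) (sym ∘ args≡ e)

≈-trans : {s t u : Sub n m n′ m′} → s ≈ t → t ≈ u → s ≈ u
≈-trans e f = mk≈ (λ x → trans (term≡ e x) (term≡ f x))
  (λ α → trans (name≡ e α) (name≡ f α)) (λ α → trans (args≡ e α) (args≡ f α))

liftλ-cong : {s t : Sub n m n′ m′} → s ≈ t → liftλ s ≈ liftλ t
liftλ-cong e = mk≈
  (λ { zero → refl ; (suc x) → cong weakenλ (term≡ e x) })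
  (name≡ e) (cong (map weakenλ) ∘ args≡ e)

liftμ-cong : {s t : Sub n m n′ m′} → s ≈ t → liftμ s ≈ liftμ t
liftμ-cong e = mk≈ (cong weakenμ ∘ term≡ e)
  (λ { zero → refl ; (suc α) → cong suc (name≡ e α) })
  (λ { zero → refl ; (suc α) → cong (map weakenμ) (args≡ e α) })

sub-cong : {s t : Sub n m n′ m′} → s ≈ t → ∀ M → sub s M ≡ sub t M
sub-cong e (var x)     = term≡ e x
sub-cong e (lam M)     = cong lam (sub-cong (liftλ-cong e) M)
sub-cong e (mu M)      = cong mu (sub-cong (liftμ-cong e) M)
sub-cong e (named α M) =
  cong₂ named (name≡ e α) (cong₂ apps (sub-cong e M) (args≡ e α))
sub-cong e (app M N)   = cong₂ app (sub-cong e M) (sub-cong e N)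

liftλ-renSub : (ρ : Fin n → Fin n′) (π : Fin m → Fin m′) →
               liftλ (renSub ρ π) ≈ renSub (lift 1 ρ) π
liftλ-renSub ρ π = mk≈ (λ { zero → refl ; (suc x) → refl }) (λ _ → refl) (λ _ → refl)

liftμ-renSub : (ρ : Fin n → Fin n′) (π : Fin m → Fin m′) →
               liftμ (renSub ρ π) ≈ renSub ρ (lift 1 π)
liftμ-renSub ρ π = mk≈ (λ _ → refl) (λ _ → refl) (λ { zero → refl ; (suc α) → refl })

lift-id : (x : Fin (suc n)) → lift 1 id x ≡ x
lift-id zero    = refl
lift-id (suc x) = refl

sub-id : (M : Tm n m) → sub (renSub id id) M ≡ M
sub-id (var x)     = refl
sub-id (lam M)     = cong lam (trans
  (sub-cong (≈-trans (liftλ-renSub id id) (mk≈ (cong var ∘ lift-id) (λ _ → refl) (λ _ → refl))) M)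
  (sub-id M))
sub-id (mu M)      = cong mu (trans
  (sub-cong (≈-trans (liftμ-renSub id id) (mk≈ (λ _ → refl) lift-id (λ _ → refl))) M)
  (sub-id M))
sub-id (named α M) = cong (named α) (sub-id M)
sub-id (app M N)   = cong₂ app (sub-id M) (sub-id N)

-- Here and in the next lemmas every operation on terms is expressed through `sub`, so that one
-- fusion law yields all commutations.
substλ≡sub : (σ : Fin n → Tm n′ m) (M : Tm n m) →
             substλ σ M ≡ sub (mkSub σ id (λ _ → [])) M
substλ≡sub σ (var x)     = refl
substλ≡sub σ (lam M)     = cong lam (substλ≡sub _ M)
substλ≡sub σ (mu M)      = cong mu (trans (substλ≡sub _ M)
  (sub-cong (mk≈ (λ _ → refl) (sym ∘ lift-id) (λ { zero → refl ; (suc α) → refl })) M))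
substλ≡sub σ (named α M) = cong (named α) (substλ≡sub σ M)
substλ≡sub σ (app M N)   = cong₂ app (substλ≡sub σ M) (substλ≡sub σ N)

renameλ≡sub : (ρ : Fin n → Fin n′) (M : Tm n m) → renameλ ρ M ≡ sub (renSub ρ id) M
renameλ≡sub ρ (var x)     = refl
renameλ≡sub ρ (lam M)     = cong lam (trans (renameλ≡sub _ M)
  (sub-cong (≈-sym (liftλ-renSub ρ id)) M))
renameλ≡sub ρ (mu M)      = cong mu (trans (renameλ≡sub ρ M)
  (sub-cong (mk≈ (λ _ → refl) (sym ∘ lift-id) (λ { zero → refl ; (suc α) → refl })) M))
renameλ≡sub ρ (named α M) = cong (named α) (renameλ≡sub ρ M)
renameλ≡sub ρ (app M N)   = cong₂ app (renameλ≡sub ρ M) (renameλ≡sub ρ N)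

renameμ≡sub : (π : Fin m → Fin m′) (M : Tm n m) → renameμ π M ≡ sub (renSub id π) M
renameμ≡sub π (var x)     = refl
renameμ≡sub π (lam M)     = cong lam (trans (renameμ≡sub π M)
  (sub-cong (mk≈ (λ { zero → refl ; (suc x) → refl }) (λ _ → refl) (λ _ → refl)) M))
renameμ≡sub π (mu M)      = cong mu (trans (renameμ≡sub _ M)
  (sub-cong (≈-sym (liftμ-renSub id π)) M))
renameμ≡sub π (named α M) = cong (named (π α)) (renameμ≡sub π M)
renameμ≡sub π (app M N)   = cong₂ app (renameμ≡sub π M) (renameμ≡sub π N)

pushArgs : Fin m → Tm n m → Fin m → List (Tm n m)
pushArgs α N β with α ≟ β
... | yes _ = [ N ]
... | no  _ = []

pushSub : Fin m → Tm n m → Sub n m n m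
pushSub α N = mkSub var id (pushArgs α N)

≔r≡sub : (M : Tm n m) (α : Fin m) (N : Tm n m) → M [ α ≔r N ] ≡ sub (pushSub α N) M
≔r≡sub (var x)     α N = refl
≔r≡sub (lam M)     α N = cong lam (trans (≔r≡sub M α (weakenλ N)) (sub-cong eq M))
  where
  eq : pushSub α (weakenλ N) ≈ liftλ (pushSub α N)
  term≡ eq zero    = refl
  term≡ eq (suc x) = refl
  name≡ eq _ = refl
  args≡ eq β with α ≟ β
  ... | yes _ = refl
  ... | no  _ = refl
≔r≡sub (mu M)      α N = cong mu (trans (≔r≡sub M (suc α) (weakenμ N)) (sub-cong eq M))
  where
  eq : pushSub (suc α) (weakenμ N) ≈ liftμ (pushSub α N)
  term≡ eq _ = refl
  name≡ eq zero    = refl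
  name≡ eq (suc β) = refl
  args≡ eq zero = refl
  args≡ eq (suc β) with α ≟ β
  ... | yes _ = refl
  ... | no  _ = refl
≔r≡sub (named β M) α N with α ≟ β
... | yes _ = cong (λ P → named β (app P N)) (≔r≡sub M α N)
... | no  _ = cong (named β) (≔r≡sub M α N)
≔r≡sub (app M P)   α N = cong₂ app (≔r≡sub M α N) (≔r≡sub P α N)

-- Fusion

sub-apps : (t : Sub n m n′ m′) (M : Tm n m) (Ls : List (Tm n m)) →
           sub t (apps M Ls) ≡ apps (sub t M) (map (sub t) Ls)
sub-apps t M []       = refl
sub-apps t M (L ∷ Ls) = sub-apps t (app M L) Ls

WeakenCommutes : Sub n m n′ m′ → Set
WeakenCommutes {n} {m} s =
  (∀ (M : Tm n m) → sub (liftλ s) (weakenλ M) ≡ weakenλ (sub s M)) ×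
  (∀ (M : Tm n m) → sub (liftμ s) (weakenμ M) ≡ weakenμ (sub s M))

LiftsCompose : Sub n m n′ m′ → Sub n′ m′ n″ m″ → Set
LiftsCompose s t =
  (liftλ s ⨾ liftλ t ≈ liftλ (s ⨾ t)) × (liftμ s ⨾ liftμ t ≈ liftμ (s ⨾ t))

-- Fusion is proved three times over (for s a renaming, for t a renaming, and
-- in general), each instance providing the weakening laws used by the next.
module Fusion
  (Q : ∀ {n m n′ m′ n″ m″} → Sub n m n′ m′ → Sub n′ m′ n″ m″ → Set)
  (Qλ : ∀ {n m n′ m′ n″ m″} {s : Sub n m n′ m′} {t : Sub n′ m′ n″ m″} →
        Q s t → Q (liftλ s) (liftλ t))
  (Qμ : ∀ {n m n′ m′ n″ m″} {s : Sub n m n′ m′} {t : Sub n′ m′ n″ m″} →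
        Q s t → Q (liftμ s) (liftμ t))
  (lifts : ∀ {n m n′ m′ n″ m″} {s : Sub n m n′ m′} {t : Sub n′ m′ n″ m″} →
        Q s t → LiftsCompose s t)
  where

  fuse : {s : Sub n m n′ m′} {t : Sub n′ m′ n″ m″} → Q s t →
         ∀ M → sub t (sub s M) ≡ sub (s ⨾ t) M
  fuse q (var x)     = refl
  fuse q (lam M)     = cong lam (trans (fuse (Qλ q) M) (sub-cong (proj₁ (lifts q)) M))
  fuse q (mu M)      = cong mu (trans (fuse (Qμ q) M) (sub-cong (proj₂ (lifts q)) M))
  fuse {s = s} {t} q (named α M) = cong (named _) (begin
    apps (sub t (apps (sub s M) (args s α))) (args t (name s α))
      ≡⟨ cong (λ P → apps P (args t (name s α))) (sub-apps t (sub s M) (args s α)) ⟩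
    apps (apps (sub t (sub s M)) (map (sub t) (args s α))) (args t (name s α))
      ≡⟨ foldl-++ app _ (map (sub t) (args s α)) (args t (name s α)) ⟨
    apps (sub t (sub s M)) (args (s ⨾ t) α)
      ≡⟨ cong (λ P → apps P (args (s ⨾ t) α)) (fuse q M) ⟩
    apps (sub (s ⨾ t) M) (args (s ⨾ t) α) ∎)
    where open ≡-Reasoning
  fuse q (app M N)   = cong₂ app (fuse q M) (fuse q N)

record IsRenaming (s : Sub n m n′ m′) : Set where
  constructor mkRen
  field
    term-var : ∀ x → ∃ λ y → term s x ≡ var y
    args-[]  : ∀ α → args s α ≡ []

open IsRenaming

liftλ-isRenaming : {s : Sub n m n′ m′} → IsRenaming s → IsRenaming (liftλ s)
term-var (liftλ-isRenaming r) zero = zero , refl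
term-var (liftλ-isRenaming r) (suc x) with term-var r x
... | y , eq = suc y , cong weakenλ eq
args-[] (liftλ-isRenaming r) α = cong (map weakenλ) (args-[] r α)

liftμ-isRenaming : {s : Sub n m n′ m′} → IsRenaming s → IsRenaming (liftμ s)
term-var (liftμ-isRenaming r) x with term-var r x
... | y , eq = y , cong weakenμ eq
args-[] (liftμ-isRenaming r) zero    = refl
args-[] (liftμ-isRenaming r) (suc α) = cong (map weakenμ) (args-[] r α)

renSub-isRenaming : {ρ : Fin n → Fin n′} {π : Fin m → Fin m′} → IsRenaming (renSub ρ π)
renSub-isRenaming = mkRen (λ x → _ , refl) (λ _ → refl)

private
  renaming-lifts : {s : Sub n m n′ m′} {t : Sub n′ m′ n″ m″} →
                   IsRenaming s → LiftsCompose s t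
  renaming-lifts {s = s} {t} r =
    mk≈ (λ { zero → refl ; (suc x) → termλ x }) (λ _ → refl) argsλ ,
    mk≈ termμ (λ { zero → refl ; (suc α) → refl }) (λ { zero → refl ; (suc α) → argsμ α })
    where
    termλ : ∀ x → sub (liftλ t) (weakenλ (term s x)) ≡ weakenλ (sub t (term s x))
    termλ x rewrite proj₂ (term-var r x) = refl
    termμ : ∀ x → sub (liftμ t) (weakenμ (term s x)) ≡ weakenμ (sub t (term s x))
    termμ x rewrite proj₂ (term-var r x) = refl
    argsλ : ∀ α → map (sub (liftλ t)) (map weakenλ (args s α)) ++ map weakenλ (args t (name s α))
                  ≡ map weakenλ (map (sub t) (args s α) ++ args t (name s α))
    argsλ α rewrite args-[] r α = refl
    argsμ : ∀ α → map (sub (liftμ t)) (map weakenμ (args s α)) ++ map weakenμ (args t (name s α))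
                  ≡ map weakenμ (map (sub t) (args s α) ++ args t (name s α))
    argsμ α rewrite args-[] r α = refl

  open Fusion (λ s _ → IsRenaming s) liftλ-isRenaming liftμ-isRenaming renaming-lifts
    renaming (fuse to fuse-renˡ)

  wkλ : Sub n m (suc n) m
  wkλ = renSub suc id

  wkμ : Sub n m n (suc m)
  wkμ = renSub id suc

  -- Weakening is a renaming, so both sides fuse to a composite of `s` with it: the left by fusion
  -- after a renaming, the right by the hypotheses.
  weaken-commutes : {s : Sub n m n′ m′} →
    (∀ M → sub wkλ (sub s M) ≡ sub (s ⨾ wkλ) M) →
    (∀ M → sub wkμ (sub s M) ≡ sub (s ⨾ wkμ) M) → WeakenCommutes s
  weaken-commutes {s = s} fλ fμ = commλ , commμ
    where
    open ≡-Reasoning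
    eqλ : wkλ ⨾ liftλ s ≈ s ⨾ wkλ
    eqλ = mk≈ (λ x → renameλ≡sub suc (term s x)) (λ _ → refl)
      (λ α → trans (map-cong (renameλ≡sub suc) (args s α)) (sym (++-identityʳ _)))
    eqμ : wkμ ⨾ liftμ s ≈ s ⨾ wkμ
    eqμ = mk≈ (λ x → renameμ≡sub suc (term s x)) (λ _ → refl)
      (λ α → trans (map-cong (renameμ≡sub suc) (args s α)) (sym (++-identityʳ _)))
    commλ : ∀ M → sub (liftλ s) (weakenλ M) ≡ weakenλ (sub s M)
    commλ M = begin
      sub (liftλ s) (weakenλ M)     ≡⟨ cong (sub (liftλ s)) (renameλ≡sub suc M) ⟩
      sub (liftλ s) (sub wkλ M)     ≡⟨ fuse-renˡ renSub-isRenaming M ⟩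
      sub (wkλ ⨾ liftλ s) M         ≡⟨ sub-cong eqλ M ⟩
      sub (s ⨾ wkλ) M               ≡⟨ fλ M ⟨
      sub wkλ (sub s M)             ≡⟨ renameλ≡sub suc (sub s M) ⟨
      weakenλ (sub s M)             ∎
    commμ : ∀ M → sub (liftμ s) (weakenμ M) ≡ weakenμ (sub s M)
    commμ M = begin
      sub (liftμ s) (weakenμ M)     ≡⟨ cong (sub (liftμ s)) (renameμ≡sub suc M) ⟩
      sub (liftμ s) (sub wkμ M)     ≡⟨ fuse-renˡ renSub-isRenaming M ⟩
      sub (wkμ ⨾ liftμ s) M         ≡⟨ sub-cong eqμ M ⟩
      sub (s ⨾ wkμ) M               ≡⟨ fμ M ⟨
      sub wkμ (sub s M)             ≡⟨ renameμ≡sub suc (sub s M) ⟨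
      weakenμ (sub s M)             ∎

  -- Composing lifts and lifting the composite differ only at weakened images, where `t` has to move
  -- past weakening.
  commuting-lifts : {s : Sub n m n′ m′} {t : Sub n′ m′ n″ m″} →
                    WeakenCommutes t → LiftsCompose s t
  commuting-lifts {s = s} {t} (cλ , cμ) =
    mk≈ (λ { zero → refl ; (suc x) → cλ (term s x) }) (λ _ → refl)
        (λ α → map-comm cλ (args s α)) ,
    mk≈ (cμ ∘ term s) (λ { zero → refl ; (suc α) → refl })
        (λ { zero → refl ; (suc α) → map-comm cμ (args s α) })
    where
    map-comm : ∀ {A B C D : Set} {f : B → D} {g : A → B} {k : C → D} {l : A → C} →
               (∀ M → f (g M) ≡ k (l M)) → ∀ Ls {Ks} →
               map f (map g Ls) ++ map k Ks ≡ map k (map l Ls ++ Ks)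
    map-comm c Ls {Ks} = trans
      (cong (_++ _) (trans (sym (map-∘ Ls)) (trans (map-cong c Ls) (map-∘ Ls))))
      (sym (map-++ _ (map _ Ls) Ks))

  renaming-weaken-commutes : {t : Sub n m n′ m′} → IsRenaming t → WeakenCommutes t
  renaming-weaken-commutes r = weaken-commutes (fuse-renˡ r) (fuse-renˡ r)

  open Fusion (λ _ t → IsRenaming t) liftλ-isRenaming liftμ-isRenaming
    (commuting-lifts ∘ renaming-weaken-commutes)
    renaming (fuse to fuse-renʳ)

sub-weaken : (t : Sub n m n′ m′) → WeakenCommutes t
sub-weaken t = weaken-commutes (fuse-renʳ renSub-isRenaming) (fuse-renʳ renSub-isRenaming)

open Fusion (λ _ _ → ⊤) (λ _ → tt) (λ _ → tt)
  (λ {_ _ _ _ _ _ _ t} _ → commuting-lifts (sub-weaken t))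
  renaming (fuse to fuse-⊤)

sub-sub : (s : Sub n m n′ m′) (t : Sub n′ m′ n″ m″) → ∀ M → sub t (sub s M) ≡ sub (s ⨾ t) M
sub-sub s t = fuse-⊤ tt

sub-weakenμ : (t : Sub n m n′ m′) → ∀ M → sub (liftμ t) (weakenμ M) ≡ weakenμ (sub t M)
sub-weakenμ t = proj₂ (sub-weaken t)

sub-∘weakenλ : (t : Sub (suc n) m n′ m′) (M : Tm n m) →
  sub t (weakenλ M) ≡ sub (mkSub (term t ∘ suc) (name t) (args t)) M
sub-∘weakenλ t M = trans (cong (sub t) (renameλ≡sub suc M)) (sub-sub _ t M)

sub-∘weakenμ : (t : Sub n (suc m) n′ m′) (M : Tm n m) →
  sub t (weakenμ M) ≡ sub (mkSub (term t) (name t ∘ suc) (args t ∘ suc)) M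
sub-∘weakenμ t M = trans (cong (sub t) (renameμ≡sub suc M)) (sub-sub _ t M)

map-cancel : ∀ {A B : Set} {f : B → A} {g : A → B} →
             (∀ x → f (g x) ≡ x) → ∀ xs → map f (map g xs) ++ [] ≡ xs
map-cancel c xs = trans (++-identityʳ _)
  (trans (sym (map-∘ xs)) (trans (map-cong c xs) (map-id xs)))

-- Substitution laws for the contractions

[≔]≡sub : (M : Tm (suc n) m) (N : Tm n m) → M [≔ N ] ≡ sub (consλ N (renSub id id)) M
[≔]≡sub M N = trans (substλ≡sub _ M)
  (sub-cong (mk≈ (λ { zero → refl ; (suc x) → refl }) (λ _ → refl) (λ _ → refl)) M)

[≔μ]≡sub : (M : Tm n (suc m)) (α : Fin m) → M [≔μ α ] ≡ sub (consμ α [] (renSub id id)) M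
[≔μ]≡sub M α = trans (renameμ≡sub _ M)
  (sub-cong (mk≈ (λ _ → refl) (λ { zero → refl ; (suc α) → refl })
    (λ { zero → refl ; (suc α) → refl })) M)

-- The contraction cancels the weakenings made by the lift, leaving one extended substitution. Cut
-- elimination thus contracts and substitutes at once.
[≔]-liftλ : (s : Sub n m n′ m′) (M : Tm (suc n) m) (N : Tm n′ m′) →
            sub (liftλ s) M [≔ N ] ≡ sub (consλ N s) M
[≔]-liftλ s M N = trans ([≔]≡sub (sub (liftλ s) M) N) (trans (sub-sub _ _ M) (sub-cong eq M))
  where
  cancel : ∀ P → sub (consλ N (renSub id id)) (weakenλ P) ≡ P
  cancel P = trans (sub-∘weakenλ _ P) (sub-id P)
  eq : liftλ s ⨾ consλ N (renSub id id) ≈ consλ N s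
  eq = mk≈ (λ { zero → refl ; (suc x) → cancel (term s x) }) (λ _ → refl)
    (λ α → map-cancel cancel (args s α))

sub-[≔] : (s : Sub n m n′ m′) (M : Tm (suc n) m) (N : Tm n m) →
          sub s (M [≔ N ]) ≡ sub (liftλ s) M [≔ sub s N ]
sub-[≔] s M N = trans (cong (sub s) ([≔]≡sub M N)) (trans (sub-sub _ s M)
  (trans (sub-cong (mk≈ (λ { zero → refl ; (suc x) → refl }) (λ _ → refl) (λ _ → refl)) M)
    (sym ([≔]-liftλ s M (sub s N)))))

[≔μ]-liftμ : (s : Sub n m n′ m′) (Ls : List (Tm n′ m′)) (M : Tm n (suc m)) (α : Fin m′) →
             sub (liftμ-push s Ls) M [≔μ α ] ≡ sub (consμ α Ls s) M
[≔μ]-liftμ s Ls M α = trans ([≔μ]≡sub (sub (liftμ-push s Ls) M) α)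
  (trans (sub-sub _ _ M) (sub-cong eq M))
  where
  cancel : ∀ P → sub (consμ α [] (renSub id id)) (weakenμ P) ≡ P
  cancel P = trans (sub-∘weakenμ _ P) (sub-id P)
  eq : liftμ-push s Ls ⨾ consμ α [] (renSub id id) ≈ consμ α Ls s
  eq = mk≈ (cancel ∘ term s) (λ { zero → refl ; (suc β) → refl })
    (λ { zero → map-cancel cancel Ls ; (suc β) → map-cancel cancel (args s β) })

-- The arguments carried by `α` must also reach the subterms named by the bound variable, which
-- becomes `α`; hence the push.
sub-[≔μ] : (s : Sub n m n′ m′) (M : Tm n (suc m)) (α : Fin m) →
           sub s (M [≔μ α ]) ≡ sub (liftμ-push s (args s α)) M [≔μ name s α ]
sub-[≔μ] s M α = trans (cong (sub s) ([≔μ]≡sub M α)) (trans (sub-sub _ s M)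
  (trans (sub-cong (mk≈ (λ _ → refl) (λ { zero → refl ; (suc α) → refl })
      (λ { zero → refl ; (suc α) → refl })) M)
    (sym ([≔μ]-liftμ s (args s α) M (name s α)))))

-- The new argument comes last because earlier ones sit further inside. Weakened terms do not
-- contain the bound name and are unaffected.
≔r-liftμ : (s : Sub n m n′ m′) (Ls : List (Tm n′ m′)) (M : Tm n (suc m)) (N : Tm n′ m′) →
           sub (liftμ-push s Ls) M [ zero ≔r weakenμ N ] ≡ sub (liftμ-push s (Ls ++ [ N ])) M
≔r-liftμ s Ls M N = trans (≔r≡sub (sub (liftμ-push s Ls) M) zero (weakenμ N))
  (trans (sub-sub _ _ M) (sub-cong eq M))
  where
  open ≡-Reasoning
  absorb : ∀ P → sub (pushSub zero (weakenμ N)) (weakenμ P) ≡ weakenμ P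
  absorb P = trans (sub-∘weakenμ _ P) (sym (renameμ≡sub suc P))
  absorb* : ∀ Ps → map (sub (pushSub zero (weakenμ N))) (map weakenμ Ps) ≡ map weakenμ Ps
  absorb* Ps = trans (sym (map-∘ Ps)) (map-cong absorb Ps)
  eq : liftμ-push s Ls ⨾ pushSub zero (weakenμ N) ≈ liftμ-push s (Ls ++ [ N ])
  eq = mk≈ (absorb ∘ term s) (λ _ → refl)
    (λ { zero → trans (cong (_++ _) (absorb* Ls)) (sym (map-++ weakenμ Ls [ N ]))
       ; (suc α) → trans (++-identityʳ _) (absorb* (args s α)) })

sub-≔r : (s : Sub n m n′ m′) (M : Tm n (suc m)) (N : Tm n m) →
         sub (liftμ s) (M [ zero ≔r weakenμ N ]) ≡
         sub (liftμ s) M [ zero ≔r weakenμ (sub s N) ]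
sub-≔r s M N = trans (cong (sub (liftμ s)) (≔r≡sub M zero (weakenμ N)))
  (trans (sub-sub _ (liftμ s) M) (trans (sub-cong eq M) (sym (≔r-liftμ s [] M (sub s N)))))
  where
  eq : pushSub zero (weakenμ N) ⨾ liftμ s ≈ liftμ-push s [ sub s N ]
  eq = mk≈ (λ _ → refl) (λ _ → refl)
    (λ { zero → cong [_] (sub-weakenμ s N) ; (suc α) → refl })

weakenμ-≔r : (M : Tm n m) (N : Tm n (suc m)) → weakenμ M [ zero ≔r N ] ≡ weakenμ M
weakenμ-≔r M N = trans (≔r≡sub (weakenμ M) zero N)
  (trans (sub-∘weakenμ _ M) (sym (renameμ≡sub suc M)))

-- Compatibility of reduction with substitution

infix 4 _⟶⁺_
_⟶⁺_ : Tm n m → Tm n m → Set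
M ⟶⁺ N = ∃ λ P → M ⟶ P × P ⟶* N

⁺⇒* : {M N : Tm n m} → M ⟶⁺ N → M ⟶* N
⁺⇒* (_ , r , rs) = r ◅ rs

⁺-map : {f : Tm n m → Tm n′ m′} → (∀ {M N} → M ⟶ N → f M ⟶ f N) →
        ∀ {M N} → M ⟶⁺ N → f M ⟶⁺ f N
⁺-map g (_ , r , rs) = _ , g r , gmap _ g rs

_*◅⁺_ : {M N P : Tm n m} → M ⟶* N → N ⟶⁺ P → M ⟶⁺ P
ε        *◅⁺ q = q
(r ◅ rs) *◅⁺ q = _ , r , rs ◅◅ ⁺⇒* q

ξ-apps : {M N : Tm n m} (Ls : List (Tm n m)) → M ⟶ N → apps M Ls ⟶ apps N Ls
ξ-apps []       r = r
ξ-apps (L ∷ Ls) r = ξ-apps Ls (ξ-appˡ r)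

-- Each argument is absorbed by one μ-contraction; `Ks` accumulates those already absorbed.
apps-mu : (s : Sub n m n′ m′) (M : Tm n (suc m)) (Ks Ls : List (Tm n′ m′)) →
          apps (mu (sub (liftμ-push s Ks) M)) Ls ⟶* mu (sub (liftμ-push s (Ks ++ Ls)) M)
apps-mu s M Ks []       =
  subst (λ Ls → mu (sub (liftμ-push s Ks) M) ⟶* mu (sub (liftμ-push s Ls) M))
    (sym (++-identityʳ Ks)) ε
apps-mu s M Ks (L ∷ Ls) = ξ-apps Ls μ-red ◅
  subst₂ (λ P Q → apps (mu P) Ls ⟶* mu Q) (sym (≔r-liftμ s Ks M L))
    (cong (λ Ls → sub (liftμ-push s Ls) M) (++-assoc Ks [ L ] Ls))
    (apps-mu s M (Ks ++ [ L ]) Ls)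

step≡ : {M N N′ : Tm n m} → M ⟶ N → N ≡ N′ → M ⟶⁺ N′
step≡ r refl = _ , r , ε

-- At least one step remains, so bounds can decrease strictly. There may be several: a ρ-redex whose
-- name carries arguments first absorbs them by μ-contractions.
sub-step : (s : Sub n m n′ m′) {M N : Tm n m} → M ⟶ N → sub s M ⟶⁺ sub s N
sub-step s (β-red {M = M} {N}) = step≡ β-red (sym (sub-[≔] s M N))
sub-step s (μ-red {M = M} {N}) = step≡ μ-red (cong mu (sym (sub-≔r s M N)))
sub-step s (ρ-red {α = α} {M}) =
  gmap (named _) ξ-named (apps-mu s M [] (args s α)) *◅⁺ step≡ ρ-red (sym (sub-[≔μ] s M α))
sub-step s (θ-red {M = M}) rewrite sub-weakenμ s M = _ , θ-red , ε
sub-step s (ξ-lam r)   = ⁺-map ξ-lam (sub-step (liftλ s) r)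
sub-step s (ξ-mu r)    = ⁺-map ξ-mu (sub-step (liftμ s) r)
sub-step s (ξ-named {α = α} r) =
  ⁺-map {f = λ P → named _ (apps P (args s α))} (ξ-named ∘ ξ-apps (args s α)) (sub-step s r)
sub-step s (ξ-appˡ r)  = ⁺-map ξ-appˡ (sub-step s r)
sub-step s (ξ-appʳ r)  = ⁺-map ξ-appʳ (sub-step s r)

[≔]-step : {M M′ : Tm (suc n) m} (N : Tm n m) → M ⟶ M′ → M [≔ N ] ⟶⁺ M′ [≔ N ]
[≔]-step {M = M} {M′} N r =
  subst₂ _⟶⁺_ (sym ([≔]≡sub M N)) (sym ([≔]≡sub M′ N)) (sub-step _ r)

≔r-step : {M M′ : Tm n m} (α : Fin m) (N : Tm n m) → M ⟶ M′ → M [ α ≔r N ] ⟶⁺ M′ [ α ≔r N ]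
≔r-step {M = M} {M′} α N r =
  subst₂ _⟶⁺_ (sym (≔r≡sub M α N)) (sym (≔r≡sub M′ α N)) (sub-step _ r)

weakenλ-step : {M M′ : Tm n m} → M ⟶ M′ → weakenλ M ⟶⁺ weakenλ M′
weakenλ-step {M = M} {M′} r =
  subst₂ _⟶⁺_ (sym (renameλ≡sub suc M)) (sym (renameλ≡sub suc M′)) (sub-step _ r)

weakenμ-step : {M M′ : Tm n m} → M ⟶ M′ → weakenμ M ⟶⁺ weakenμ M′
weakenμ-step {M = M} {M′} r =
  subst₂ _⟶⁺_ (sym (renameμ≡sub suc M)) (sym (renameμ≡sub suc M′)) (sub-step _ r)

-- Monotonicity in the substituted term

*-bind : {f : Tm n m → Tm n′ m′} → (∀ {M N} → M ⟶ N → f M ⟶⁺ f N) →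
         ∀ {M N} → M ⟶* N → f M ⟶* f N
*-bind g ε        = ε
*-bind g (r ◅ rs) = ⁺⇒* (g r) ◅◅ *-bind g rs

app-mono : {M M′ N N′ : Tm n m} → M ⟶* M′ → N ⟶* N′ → app M N ⟶* app M′ N′
app-mono rs qs = gmap (λ P → app P _) ξ-appˡ rs ◅◅ gmap (app _) ξ-appʳ qs

substλ-mono : {σ τ : Fin n → Tm n′ m} → (∀ x → σ x ⟶* τ x) →
              ∀ M → substλ σ M ⟶* substλ τ M
substλ-mono h (var x)     = h x
substλ-mono h (lam M)     = gmap lam ξ-lam
  (substλ-mono (λ { zero → ε ; (suc x) → *-bind weakenλ-step (h x) }) M)
substλ-mono h (mu M)      = gmap mu ξ-mu (substλ-mono (λ x → *-bind weakenμ-step (h x)) M)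
substλ-mono h (named α M) = gmap (named α) ξ-named (substλ-mono h M)
substλ-mono h (app M N)   = app-mono (substλ-mono h M) (substλ-mono h N)

[≔]-mono : (M : Tm (suc n) m) {N N′ : Tm n m} → N ⟶ N′ → M [≔ N ] ⟶* M [≔ N′ ]
[≔]-mono M r = substλ-mono (λ { zero → r ◅ ε ; (suc x) → ε }) M

≔r-mono : (M : Tm n m) (α : Fin m) {N N′ : Tm n m} → N ⟶* N′ → M [ α ≔r N ] ⟶* M [ α ≔r N′ ]
≔r-mono (var x)     α rs = ε
≔r-mono (lam M)     α rs = gmap lam ξ-lam (≔r-mono M α (*-bind weakenλ-step rs))
≔r-mono (mu M)      α rs = gmap mu ξ-mu (≔r-mono M (suc α) (*-bind weakenμ-step rs))
≔r-mono (named β M) α rs with α ≟ β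
... | yes _ = gmap (named β) ξ-named (app-mono (≔r-mono M α rs) rs)
... | no  _ = gmap (named β) ξ-named (≔r-mono M α rs)
≔r-mono (app M N)   α rs = app-mono (≔r-mono M α rs) (≔r-mono N α rs)

-- Renaming of μ-variables reflects reduction

∈Fvμ-rename : (π : Fin m → Fin m′) {α : Fin m} (M : Tm n m) →
              α ∈Fvμ M → π α ∈Fvμ renameμ π M
∈Fvμ-rename π (lam M)     i           = ∈Fvμ-rename π M i
∈Fvμ-rename π (mu M)      i           = ∈Fvμ-rename (lift 1 π) M i
∈Fvμ-rename π (named β M) (inj₁ refl) = inj₁ refl
∈Fvμ-rename π (named β M) (inj₂ i)    = inj₂ (∈Fvμ-rename π M i)
∈Fvμ-rename π (app M N)   (inj₁ i)    = inj₁ (∈Fvμ-rename π M i)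
∈Fvμ-rename π (app M N)   (inj₂ i)    = inj₂ (∈Fvμ-rename π N i)

renameμ-liftλ : (π : Fin m → Fin m′) (M : Tm (suc n) m) →
                sub (liftλ (renSub id π)) M ≡ renameμ π M
renameμ-liftλ π M = sym (trans (renameμ≡sub π M)
  (sub-cong (mk≈ (λ { zero → refl ; (suc x) → refl }) (λ _ → refl) (λ _ → refl)) M))

renameμ-liftμ : (π : Fin m → Fin m′) (M : Tm n (suc m)) →
                sub (liftμ (renSub id π)) M ≡ renameμ (lift 1 π) M
renameμ-liftμ π M =
  sym (trans (renameμ≡sub _ M) (sub-cong (≈-sym (liftμ-renSub id π)) M))

renameμ-[≔] : (π : Fin m → Fin m′) (M : Tm (suc n) m) (N : Tm n m) →
              renameμ π M [≔ renameμ π N ] ≡ renameμ π (M [≔ N ])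
renameμ-[≔] π M N = sym (trans (renameμ≡sub π _) (trans (sub-[≔] _ M N)
  (cong₂ _[≔_] (renameμ-liftλ π M) (sym (renameμ≡sub π N)))))

renameμ-≔r : (π : Fin m → Fin m′) (M : Tm n (suc m)) (N : Tm n m) →
             renameμ (lift 1 π) M [ zero ≔r weakenμ (renameμ π N) ] ≡
             renameμ (lift 1 π) (M [ zero ≔r weakenμ N ])
renameμ-≔r π M N = sym (trans (sym (renameμ-liftμ π _)) (trans (sub-≔r _ M N)
  (cong₂ (λ P Q → P [ zero ≔r weakenμ Q ]) (renameμ-liftμ π M) (sym (renameμ≡sub π N)))))

renameμ-[≔μ] : (π : Fin m → Fin m′) (M : Tm n (suc m)) (α : Fin m) →
               renameμ (lift 1 π) M [≔μ π α ] ≡ renameμ π (M [≔μ α ])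
renameμ-[≔μ] π M α = sym (trans (renameμ≡sub π _) (trans (sub-[≔μ] _ M α)
  (cong _[≔μ π α ] (renameμ-liftμ π M))))

renameμ-weakenμ : (π : Fin m → Fin m′) (M : Tm n m) →
                  renameμ (lift 1 π) (weakenμ M) ≡ weakenμ (renameμ π M)
renameμ-weakenμ π M = trans (sym (renameμ-liftμ π _))
  (trans (sub-weakenμ _ M) (cong weakenμ (sym (renameμ≡sub π M))))

weakenμ-[≔μ] : (M : Tm n m) (α : Fin m) → weakenμ M [≔μ α ] ≡ M
weakenμ-[≔μ] M α = trans ([≔μ]≡sub (weakenμ M) α) (trans (sub-∘weakenμ _ M) (sub-id M))

-- The θ case becomes an equation on the body, which can still be analysed when the body is a
-- renamed term.
mu-step-inv : {M : Tm n (suc m)} {P : Tm n m} → mu M ⟶ P →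
              (∃ λ M′ → M ⟶ M′ × P ≡ mu M′) ⊎ M ≡ named zero (weakenμ P)
mu-step-inv θ-red    = inj₂ refl
mu-step-inv (ξ-mu r) = inj₁ (_ , r , refl)

unname : Tm n m → Tm n m
unname (named α M) = M
unname M           = M

-- Renaming preserves occurrences, so `zero` free under the name would be free in `weakenμ P`. Hence
-- that subterm is itself a weakening.
renameμ-θ-inv : (π : Fin m → Fin m′) (M : Tm n (suc m)) {P : Tm n m′} →
                renameμ (lift 1 π) M ≡ named zero (weakenμ P) →
                ∃ λ M′ → M ≡ named zero (weakenμ M′) × weakenμ P ≡ weakenμ (renameμ π M′)
renameμ-θ-inv π (named zero M) {P} eq with Equivalence.to (∉Fvμ⇔weakenμ {M = M}) ∉M
  where
  ∉M : ¬ zero ∈Fvμ M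
  ∉M i = Equivalence.from ∉Fvμ⇔weakenμ (P , cong unname eq) (∈Fvμ-rename (lift 1 π) M i)
... | M′ , refl = M′ , refl , trans (sym (cong unname eq)) (renameμ-weakenμ π M′)
-- The inhabitant of Fin m′ makes weakenμ cancellable on Tm n m′.
renameμ-reflect : Fin m′ → (π : Fin m → Fin m′) (M : Tm n m) {P : Tm n m′} →
                  renameμ π M ⟶ P → ∃ λ M′ → M ⟶ M′ × P ≡ renameμ π M′
renameμ-reflect α₀ π (lam M) (ξ-lam r) with renameμ-reflect α₀ π M r
... | _ , r′ , eq = _ , ξ-lam r′ , cong lam eq
renameμ-reflect α₀ π (mu M) {P} r with mu-step-inv r
... | inj₁ (_ , q , refl) with renameμ-reflect zero (lift 1 π) M q
...   | _ , q′ , eq = _ , ξ-mu q′ , cong mu eq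
renameμ-reflect α₀ π (mu M) {P} r | inj₂ eq with renameμ-θ-inv π M eq
... | M′ , refl , eq′ = M′ , θ-red , (begin
      P                               ≡⟨ weakenμ-[≔μ] P α₀ ⟨
      weakenμ P [≔μ α₀ ]              ≡⟨ cong _[≔μ α₀ ] eq′ ⟩
      weakenμ (renameμ π M′) [≔μ α₀ ] ≡⟨ weakenμ-[≔μ] _ α₀ ⟩
      renameμ π M′                    ∎)
  where open ≡-Reasoning
renameμ-reflect α₀ π (named α (mu M)) ρ-red = _ , ρ-red , renameμ-[≔μ] π M α
renameμ-reflect α₀ π (named α M) (ξ-named r) with renameμ-reflect α₀ π M r
... | _ , r′ , eq = _ , ξ-named r′ , cong (named (π α)) eq
renameμ-reflect α₀ π (app (lam M) N) β-red = _ , β-red , renameμ-[≔] π M N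
renameμ-reflect α₀ π (app (mu M) N)  μ-red = _ , μ-red , cong mu (renameμ-≔r π M N)
renameμ-reflect α₀ π (app M N) (ξ-appˡ r) with renameμ-reflect α₀ π M r
... | _ , r′ , eq = _ , ξ-appˡ r′ , cong (λ P → app P (renameμ π N)) eq
renameμ-reflect α₀ π (app M N) (ξ-appʳ r) with renameμ-reflect α₀ π N r
... | _ , r′ , eq = _ , ξ-appʳ r′ , cong (app (renameμ π M)) eq

-- Bounds on the lengths of reduction sequences

-- Accessibility under reduction with a numerical bound. The bound is strict: a normal term has
-- bound 1, and no term has bound 0.
data Bounded {n m} : ℕ → Tm n m → Set where
  bounded : ∀ {k M} → (∀ {M′} → M ⟶ M′ → Bounded k M′) → Bounded (suc k) M

Bounded⇒length< : ∀ {k} {M N : Tm n m} → Bounded k M → (rs : M ⟶* N) → length rs < k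
Bounded⇒length< (bounded h) ε        = s≤s z≤n
Bounded⇒length< (bounded h) (r ◅ rs) = s≤s (Bounded⇒length< (h r) rs)

Bounded-mono : ∀ {k l} {M : Tm n m} → k ≤ l → Bounded k M → Bounded l M
Bounded-mono (s≤s k≤l) (bounded h) = bounded λ r → Bounded-mono k≤l (h r)

Bounded-⟶* : ∀ {k} {M N : Tm n m} → M ⟶* N → Bounded k M → Bounded k N
Bounded-⟶* ε        b           = b
Bounded-⟶* (r ◅ rs) (bounded h) = Bounded-mono (n≤1+n _) (Bounded-⟶* rs (h r))

Bounded-⟶⁺ : ∀ {k} {M N : Tm n m} → M ⟶⁺ N → Bounded (suc k) M → Bounded k N
Bounded-⟶⁺ (_ , r , rs) (bounded h) = Bounded-⟶* rs (h r)

-- Renaming creates no redexes, even when it identifies names: every reduct of the renamed term is a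
-- renamed reduct.
Bounded-renameμ : ∀ {k} → Fin m′ → (π : Fin m → Fin m′) {M : Tm n m} →
                  Bounded k M → Bounded k (renameμ π M)
Bounded-renameμ {k = suc k} α₀ π {M} (bounded h) = bounded reduct
  where
  reduct : ∀ {P} → renameμ π M ⟶ P → Bounded k P
  reduct r with renameμ-reflect α₀ π M r
  ... | _ , r′ , refl = Bounded-renameμ α₀ π (h r′)

Bounded-weakenμ⁻ : ∀ {k} {M : Tm n m} → Bounded k (weakenμ M) → Bounded k M
Bounded-weakenμ⁻ {k = suc k} b =
  bounded λ r → Bounded-weakenμ⁻ (Bounded-⟶⁺ (weakenμ-step r) b)

Bounded-named⁻ : ∀ {k} {α : Fin m} {M : Tm n m} → Bounded k (named α M) → Bounded k M
Bounded-named⁻ (bounded h) = bounded λ r → Bounded-named⁻ (h (ξ-named r))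

Bounded-mu⁻ : ∀ {k} {M : Tm n (suc m)} → Bounded k (mu M) → Bounded k M
Bounded-mu⁻ (bounded h) = bounded λ r → Bounded-mu⁻ (h (ξ-mu r))

Bounded-var : ∀ {k} {x : Fin n} → Bounded {m = m} (suc k) (var x)
Bounded-var = bounded λ ()

Bounded-lam : ∀ {k} {M : Tm (suc n) m} → Bounded k M → Bounded k (lam M)
Bounded-lam (bounded h) = bounded λ { (ξ-lam r) → Bounded-lam (h r) }

-- A root θ-step costs one and leaves, up to weakening, a subterm of the body, to which the bound of
-- the body still applies.
Bounded-mu : ∀ {k} {M : Tm n (suc m)} → Bounded k M → Bounded (suc k) (mu M)
Bounded-mu b@(bounded h) = bounded λ
  { (ξ-mu r) → Bounded-mu (h r)
  ; θ-red    → Bounded-weakenμ⁻ (Bounded-named⁻ b) }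

Bounded-named : ∀ {k} {α : Fin m} {M : Tm n m} → Bounded k M → Bounded (suc k) (named α M)
Bounded-named {α = α} b@(bounded h) = bounded λ
  { (ξ-named r) → Bounded-named (h r)
  ; ρ-red       → Bounded-renameμ α _ (Bounded-mu⁻ b) }

data Neutral {n m} : Tm n m → Set where
  var : ∀ {x} → Neutral (var x)
  app : ∀ {M N} → Neutral M → Neutral (app M N)

Neutral-step : {M N : Tm n m} → Neutral M → M ⟶ N → Neutral N
Neutral-step (app ν) (ξ-appˡ r) = app (Neutral-step ν r)
Neutral-step (app ν) (ξ-appʳ r) = app ν

-- A neutral operator never becomes a `lam` or `mu`, so every step is inside one of the two parts
-- and lowers its bound.
Bounded-neutral-app : ∀ {k l} {M N : Tm n m} → Neutral M →
                      Bounded k M → Bounded l N → Bounded (k + l) (app M N)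
Bounded-neutral-app {k = suc k} {suc l} {M} {N} ν b@(bounded h) c@(bounded g) = bounded reduct
  where
  reduct : ∀ {P} → app M N ⟶ P → Bounded (k + suc l) P
  reduct (ξ-appˡ r) = Bounded-neutral-app (Neutral-step ν r) (h r) c
  reduct (ξ-appʳ r) = Bounded-mono (≤-reflexive (sym (+-suc k l))) (Bounded-neutral-app ν b (g r))
  reduct β-red = contradiction ν λ ()
  reduct μ-red = contradiction ν λ ()

-- Head P P′ Q: contracting the head redex of P, whose argument is Q, gives P′.
data Head {n m} : Tm n m → Tm n m → Tm n m → Set where
  hβ   : ∀ {M N} → Head (app (lam M) N) (M [≔ N ]) N
  hμ   : ∀ {M N} → Head (app (mu M) N) (mu (M [ zero ≔r weakenμ N ])) N
  happ : ∀ {P P′ Q L} → Head P P′ Q → Head (app P L) (app P′ L) Q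

-- How the contractum `P′` follows a step from `P` to `P₁`. In `body` it moves at least once. In
-- `arg` it may stand still, since the argument may be erased, but then `Q` moves.
data HeadStep {n m} (P′ Q P₁ : Tm n m) : Set where
  done : P′ ⟶* P₁ → HeadStep P′ Q P₁
  body : ∀ {P₁′} → Head P₁ P₁′ Q → P′ ⟶⁺ P₁′ → HeadStep P′ Q P₁
  arg  : ∀ {P₁′ Q₁} → Head P₁ P₁′ Q₁ → P′ ⟶* P₁′ → Q ⟶ Q₁ → HeadStep P′ Q P₁

head-step : {P P′ Q P₁ : Tm n m} → Head P P′ Q → P ⟶ P₁ → HeadStep P′ Q P₁
head-step hβ β-red              = done ε
head-step (hβ {N = N}) (ξ-appˡ (ξ-lam r)) = body hβ ([≔]-step N r)
head-step (hβ {M = M}) (ξ-appʳ r) = arg hβ ([≔]-mono M r) r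
head-step hμ μ-red              = done ε
-- (μα.[α]M)N contracts to μα.[α](M N), still a θ-redex.
head-step (hμ {N = N}) (ξ-appˡ (θ-red {M = M})) =
  done (subst (λ P → mu (named zero (app P (weakenμ N))) ⟶* app M N)
    (sym (weakenμ-≔r M (weakenμ N))) (θ-red ◅ ε))
head-step (hμ {N = N}) (ξ-appˡ (ξ-mu r)) = body hμ (⁺-map ξ-mu (≔r-step zero (weakenμ N) r))
head-step (hμ {M = M}) (ξ-appʳ r) =
  arg hμ (gmap mu ξ-mu (≔r-mono M zero (⁺⇒* (weakenμ-step r)))) r
head-step (happ h) (ξ-appˡ r) with head-step h r
... | done rs    = done (gmap _ ξ-appˡ rs)
... | body h′ rs = body (happ h′) (⁺-map ξ-appˡ rs)
... | arg h′ rs q = arg (happ h′) (gmap _ ξ-appˡ rs) q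
head-step (happ h) (ξ-appʳ r)  = body (happ h) (_ , ξ-appʳ r , ε)

-- Steps that keep a head redex lower the bound of the contractum or that of the argument.
Bounded-head : ∀ {k l} {P P′ Q : Tm n m} → Head P P′ Q →
               Bounded k P′ → Bounded l Q → Bounded (k + l) P
Bounded-head {k = suc k} {suc l} {P} h b c@(bounded g) = bounded reduct
  where
  reduct : ∀ {P₁} → P ⟶ P₁ → Bounded (k + suc l) P₁
  reduct r with head-step h r
  -- The step that removes the head redex is paid for by the bound of `Q`, which is at least one.
  ... | done rs     = Bounded-mono (≤-trans (s≤s (m≤m+n k l)) (≤-reflexive (sym (+-suc k l))))
                        (Bounded-⟶* rs b)
  ... | body h′ rs  = Bounded-head h′ (Bounded-⟶⁺ rs b) c
  ... | arg h′ rs q = Bounded-mono (≤-reflexive (sym (+-suc k l)))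
                        (Bounded-head h′ (Bounded-⟶* rs b) (g q))

-- Trees with cuts

data NeutralOrCut (r : ℕ) {n m} (M : Tm n m) (C : Ty) : Set where
  neutral : Neutral M → NeutralOrCut r M C
  cut     : lh C ≤ r → NeutralOrCut r M C

-- Leaves have every height, so heights are upper bounds. `head` imposes no condition on `r`: a
-- contracted redex is no longer a cut.
data Tree (r : ℕ) {n m} (Γ : Vec Ty n) (Δ : Vec Ty m) : Tm n m → Ty → ℕ → Set where
  var   : ∀ {x A a} → lookup Γ x ≡ A → Tree r Γ Δ (var x) A a
  lam   : ∀ {M A B a} → Tree r (A ∷ Γ) Δ M B a → Tree r Γ Δ (lam M) (A ⇒ B) (suc a)
  mu    : ∀ {M A a} → Tree r Γ (A ∷ Δ) M ⊥̇ a → Tree r Γ Δ (mu M) A (suc a)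
  named : ∀ {α M A a} → lookup Δ α ≡ A → Tree r Γ Δ M A a →
          Tree r Γ Δ (named α M) ⊥̇ (suc a)
  app   : ∀ {M N A B a} → NeutralOrCut r M (A ⇒ B) →
          Tree r Γ Δ M (A ⇒ B) a → Tree r Γ Δ N A a → Tree r Γ Δ (app M N) B (suc a)
  head  : ∀ {P P′ Q A B a} → Head P P′ Q →
          Tree r Γ Δ P′ B a → Tree r Γ Δ Q A a → Tree r Γ Δ P B (suc a)

private variable
  Γ Γ′ : Vec Ty n
  Δ Δ′ : Vec Ty m
  M N P P′ Q : Tm n m
  A B C : Ty
  r a b : ℕ

double-2^ : ∀ a → 2 ^ a + 2 ^ a ≡ 2 ^ suc a
double-2^ a = cong (2 ^ a +_) (sym (+-identityʳ _))

suc-2^≤ : ∀ a → suc (2 ^ a) ≤ 2 ^ suc a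
suc-2^≤ a = ≤-trans (+-monoˡ-≤ (2 ^ a) (m^n>0 2 a)) (≤-reflexive (double-2^ a))

lh-domain : lh (A ⇒ B) ≤ suc r → lh A ≤ r
lh-domain {A} {B} {r} p = ≤-trans (m≤m+n (lh A) (lh B))
  (s≤s⁻¹ (subst (_≤ suc r) (+-comm (lh A + lh B) 1) p))

app-neutral-or-cut : NeutralOrCut r M (A ⇒ B) → NeutralOrCut r (app M N) B
app-neutral-or-cut (neutral ν)     = neutral (app ν)
app-neutral-or-cut {A = A} (cut p) = cut (≤-trans (≤-trans (m≤n+m _ (lh A)) (m≤m+n _ 1)) p)

-- An arrow type has positive length.
cut-free : NeutralOrCut 0 M (A ⇒ B) → Neutral M
cut-free (neutral ν) = ν
cut-free {A = A} {B} (cut p) with ≤-trans (m≤n+m 1 (lh A + lh B)) p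
... | ()

-- Nodes with two premises add two bounds `2 ^ a`; the single step for `mu` or `named` fits into the
-- same doubling.
Tree-Bounded : Tree 0 Γ Δ M A a → Bounded (2 ^ a) M
Tree-Bounded {a = a} (var _) = Bounded-mono (m^n>0 2 a) Bounded-var
Tree-Bounded {a = suc a} (lam d) =
  Bounded-mono (m≤m+n (2 ^ a) _) (Bounded-lam (Tree-Bounded d))
Tree-Bounded {a = suc a} (mu d) = Bounded-mono (suc-2^≤ a) (Bounded-mu (Tree-Bounded d))
Tree-Bounded {a = suc a} (named _ d) =
  Bounded-mono (suc-2^≤ a) (Bounded-named (Tree-Bounded d))
Tree-Bounded {a = suc a} (app o d e) = Bounded-mono (≤-reflexive (double-2^ a))
  (Bounded-neutral-app (cut-free o) (Tree-Bounded d) (Tree-Bounded e))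
Tree-Bounded {a = suc a} (head h d e) = Bounded-mono (≤-reflexive (double-2^ a))
  (Bounded-head h (Tree-Bounded d) (Tree-Bounded e))

Tree-mono : a ≤ b → Tree r Γ Δ M A a → Tree r Γ Δ M A b
Tree-mono p       (var eq)     = var eq
Tree-mono (s≤s p) (lam d)      = lam (Tree-mono p d)
Tree-mono (s≤s p) (mu d)       = mu (Tree-mono p d)
Tree-mono (s≤s p) (named eq d) = named eq (Tree-mono p d)
Tree-mono (s≤s p) (app o d e)  = app o (Tree-mono p d) (Tree-mono p e)
Tree-mono (s≤s p) (head h d e) = head h (Tree-mono p d) (Tree-mono p e)

Tree-suc : Tree r Γ Δ M A a → Tree r Γ Δ M A (suc a)
Tree-suc = Tree-mono (n≤1+n _)

-- Both contractions commute exactly with substitution, so `head` nodes survive it.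
Head-sub : (s : Sub n m n′ m′) → Head P P′ Q → Head (sub s P) (sub s P′) (sub s Q)
Head-sub s (hβ {M} {N}) = subst (λ P → Head (sub s (app (lam M) N)) P (sub s N))
  (sym (sub-[≔] s M N)) hβ
Head-sub s (hμ {M} {N}) = subst (λ P → Head (sub s (app (mu M) N)) (mu P) (sub s N))
  (sym (sub-≔r s M N)) hμ
Head-sub s (happ h)     = happ (Head-sub s h)

¬Head-Neutral : Neutral P → ¬ Head P P′ Q
¬Head-Neutral (app ν) (happ h) = ¬Head-Neutral ν h

-- Renaming of trees

record TypedRenaming (s : Sub n m n′ m′) (Γ : Vec Ty n) (Δ : Vec Ty m)
                     (Γ′ : Vec Ty n′) (Δ′ : Vec Ty m′) : Set where
  field
    term-var : ∀ x → ∃ λ y → term s x ≡ var y × lookup Γ′ y ≡ lookup Γ x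
    args-[]  : ∀ α → args s α ≡ [] × lookup Δ′ (name s α) ≡ lookup Δ α

open TypedRenaming

liftλ-typed : {s : Sub n m n′ m′} → TypedRenaming s Γ Δ Γ′ Δ′ →
              TypedRenaming (liftλ s) (A ∷ Γ) Δ (A ∷ Γ′) Δ′
term-var (liftλ-typed t) zero = zero , refl , refl
term-var (liftλ-typed t) (suc x) with term-var t x
... | y , eq , ty = suc y , cong weakenλ eq , ty
args-[] (liftλ-typed t) α with args-[] t α
... | eq , ty = cong (map weakenλ) eq , ty

liftμ-typed : {s : Sub n m n′ m′} → TypedRenaming s Γ Δ Γ′ Δ′ →
              TypedRenaming (liftμ s) Γ (A ∷ Δ) Γ′ (A ∷ Δ′)
term-var (liftμ-typed t) x with term-var t x
... | y , eq , ty = y , cong weakenμ eq , ty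
args-[] (liftμ-typed t) zero = refl , refl
args-[] (liftμ-typed t) (suc α) with args-[] t α
... | eq , ty = cong (map weakenμ) eq , ty

Neutral-rename : {s : Sub n m n′ m′} → TypedRenaming s Γ Δ Γ′ Δ′ →
                 Neutral M → Neutral (sub s M)
Neutral-rename t (var {x}) rewrite proj₁ (proj₂ (term-var t x)) = var
Neutral-rename t (app ν) = app (Neutral-rename t ν)

Tree-rename : {s : Sub n m n′ m′} → TypedRenaming s Γ Δ Γ′ Δ′ →
              Tree r Γ Δ M A a → Tree r Γ′ Δ′ (sub s M) A a
Tree-rename t (var {x} refl) with term-var t x
... | y , eq , ty rewrite eq = var ty
Tree-rename t (lam d) = lam (Tree-rename (liftλ-typed t) d)
Tree-rename t (mu d)  = mu (Tree-rename (liftμ-typed t) d)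
Tree-rename t (named {α} refl d) with args-[] t α
... | eq , ty rewrite eq = named ty (Tree-rename t d)
Tree-rename t (app (neutral ν) d e) =
  app (neutral (Neutral-rename t ν)) (Tree-rename t d) (Tree-rename t e)
Tree-rename t (app (cut p) d e) = app (cut p) (Tree-rename t d) (Tree-rename t e)
Tree-rename t (head h d e) = head (Head-sub _ h) (Tree-rename t d) (Tree-rename t e)

Tree-weakenλ : Tree r Γ Δ M A a → Tree r (C ∷ Γ) Δ (weakenλ M) A a
Tree-weakenλ {M = M} d = subst (λ P → Tree _ _ _ P _ _) (sym (renameλ≡sub suc M))
  (Tree-rename
    (record { term-var = λ x → suc x , refl , refl ; args-[] = λ α → refl , refl }) d)

Tree-weakenμ : Tree r Γ Δ M A a → Tree r Γ (C ∷ Δ) (weakenμ M) A a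
Tree-weakenμ {M = M} d = subst (λ P → Tree _ _ _ P _ _) (sym (renameμ≡sub suc M))
  (Tree-rename (record { term-var = λ x → x , refl , refl ; args-[] = λ α → refl , refl }) d)

-- Cut elimination

-- Every term substituted for a λ-variable, or pushed as an argument under the
-- name of a μ-variable, has type A and height b.
module CutReduction {r b : ℕ} {A : Ty} (A≤r : lh A ≤ r) where

  GoodTerm : Vec Ty n → Vec Ty m → Tm n m → Ty → Set
  GoodTerm Γ Δ M C = (∃ λ y → M ≡ var y × lookup Γ y ≡ C) ⊎ (C ≡ A × Tree r Γ Δ M A b)

  -- A pushed argument consumes the domain of the declared type: a name declared at `A ⇒ B` in the
  -- source is declared at `B` in the target.
  GoodArgs : Vec Ty n → Vec Ty m → Fin m → List (Tm n m) → Ty → Set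
  GoodArgs Γ Δ α Ls C = (Ls ≡ [] × lookup Δ α ≡ C) ⊎
    (∃ λ N → Ls ≡ [ N ] × C ≡ A ⇒ lookup Δ α × Tree r Γ Δ N A b)

  record Good (s : Sub n m n′ m′) (Γ : Vec Ty n) (Δ : Vec Ty m)
              (Γ′ : Vec Ty n′) (Δ′ : Vec Ty m′) : Set where
    field
      good-term : ∀ x → GoodTerm Γ′ Δ′ (term s x) (lookup Γ x)
      good-args : ∀ α → GoodArgs Γ′ Δ′ (name s α) (args s α) (lookup Δ α)

  open Good

  good-id : Good (renSub id id) Γ Δ Γ Δ
  good-term good-id x = inj₁ (x , refl , refl)
  good-args good-id α = inj₁ (refl , refl)

  good-consλ : {s : Sub n m n′ m′} → Good s Γ Δ Γ′ Δ′ → Tree r Γ′ Δ′ N A b →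
               Good (consλ N s) (A ∷ Γ) Δ Γ′ Δ′
  good-term (good-consλ g e) zero    = inj₂ (refl , e)
  good-term (good-consλ g e) (suc x) = good-term g x
  good-args (good-consλ g e) = good-args g

  good-liftλ : {s : Sub n m n′ m′} → Good s Γ Δ Γ′ Δ′ →
               Good (liftλ s) (C ∷ Γ) Δ (C ∷ Γ′) Δ′
  good-term (good-liftλ g) zero = inj₁ (zero , refl , refl)
  good-term (good-liftλ g) (suc x) with good-term g x
  ... | inj₁ (y , eq , ty) = inj₁ (suc y , cong weakenλ eq , ty)
  ... | inj₂ (eq , d)      = inj₂ (eq , Tree-weakenλ d)
  good-args (good-liftλ g) α with good-args g α
  ... | inj₁ (eq , ty)         = inj₁ (cong (map weakenλ) eq , ty)
  ... | inj₂ (N , eq , ty , d) = inj₂ (weakenλ N , cong (map weakenλ) eq , ty , Tree-weakenλ d)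

  good-liftμ-push : {s : Sub n m n′ m′} {Ls : List (Tm n′ m′)} → Good s Γ Δ Γ′ Δ′ →
    GoodArgs Γ′ (B ∷ Δ′) zero (map weakenμ Ls) C →
    Good (liftμ-push s Ls) Γ (C ∷ Δ) Γ′ (B ∷ Δ′)
  good-term (good-liftμ-push g h) x with good-term g x
  ... | inj₁ (y , eq , ty) = inj₁ (y , cong weakenμ eq , ty)
  ... | inj₂ (eq , d)      = inj₂ (eq , Tree-weakenμ d)
  good-args (good-liftμ-push g h) zero = h
  good-args (good-liftμ-push g h) (suc α) with good-args g α
  ... | inj₁ (eq , ty)         = inj₁ (cong (map weakenμ) eq , ty)
  ... | inj₂ (N , eq , ty , d) = inj₂ (weakenμ N , cong (map weakenμ) eq , ty , Tree-weakenμ d)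

  -- Neutrality is lost only if the head variable, then of type `A`, is replaced by a tree. Types
  -- shorten along the spine, so the bound `r` persists.
  neutral-or-cut : {s : Sub n m n′ m′} → Good s Γ Δ Γ′ Δ′ → Tree r Γ Δ M C a →
                   Neutral M → NeutralOrCut r (sub s M) C
  neutral-or-cut g (var {x} refl) var with good-term g x
  ... | inj₁ (_ , eq , _) rewrite eq = neutral var
  ... | inj₂ (eq , _)     rewrite eq = cut A≤r
  neutral-or-cut g (app _ d e) (app ν) =
    app-neutral-or-cut (neutral-or-cut g d ν)
  neutral-or-cut g (head h d e) ν = contradiction h (¬Head-Neutral ν)

  cut-sub : {s : Sub n m n′ m′} → Good s Γ Δ Γ′ Δ′ → Tree r Γ Δ M C a →
            NeutralOrCut r M C → NeutralOrCut r (sub s M) C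
  cut-sub g d (neutral ν) = neutral-or-cut g d ν
  cut-sub g d (cut p)     = cut p

  -- Pushing N under [α]U creates the application of U to N, and applying μα.M
  -- to N pushes N into M.
  Tree-sub : {s : Sub n m n′ m′} → Good s Γ Δ Γ′ Δ′ → Tree r Γ Δ M C a →
             Tree r Γ′ Δ′ (sub s M) C (a * 2 + b)
  Tree-app : {s : Sub n m n′ m′} → Good s Γ Δ Γ′ Δ′ → Tree r Γ Δ M (A ⇒ B) a →
             Tree r Γ′ Δ′ N A b → Tree r Γ′ Δ′ (app (sub s M) N) B (suc (a * 2 + b))

  Tree-sub g (var {x} refl) with good-term g x
  ... | inj₁ (y , eq , ty) rewrite eq = var ty
  Tree-sub {a = a} g (var {x} refl) | inj₂ (eq , d) rewrite eq = Tree-mono (m≤n+m b (a * 2)) d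
  Tree-sub g (lam d) = Tree-suc (lam (Tree-sub (good-liftλ g) d))
  Tree-sub g (mu d)  = Tree-suc (mu (Tree-sub (good-liftμ-push g (inj₁ (refl , refl))) d))
  Tree-sub g (named {α} refl d) with good-args g α
  ... | inj₁ (eq , ty) rewrite eq = Tree-suc (named ty (Tree-sub g d))
  -- One node becomes two, a name and an application: the source of the factor 2 in the height.
  ... | inj₂ (N , eq , ty , e) rewrite eq =
    named refl (Tree-app g (subst (λ C → Tree _ _ _ _ C _) ty d) e)
  Tree-sub g (app o d e)  = Tree-suc (app (cut-sub g d o) (Tree-sub g d) (Tree-sub g e))
  Tree-sub g (head h d e) = Tree-suc (head (Head-sub _ h) (Tree-sub g d) (Tree-sub g e))

  Tree-app {a = a} g d@(var _) e =
    app (neutral-or-cut g d var) (Tree-sub {a = a} g d) (Tree-mono (m≤n+m b (a * 2)) e)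
  -- The β-redex is contracted by adding `N` to the substitution for the body; `N` is also kept as
  -- second premise.
  Tree-app {N = N} {s = s} g (lam {M} {a = a} d) e = Tree-mono (m≤n+m _ 2)
    (head hβ (subst (λ P → Tree _ _ _ P _ _) (sym ([≔]-liftλ s M N)) (Tree-sub (good-consλ g e) d))
      (Tree-mono (m≤n+m b (a * 2)) e))
  Tree-app {N = N} {s = s} g (mu {M} {a = a} d) e = Tree-suc
    (head hμ (mu (subst (λ P → Tree _ _ _ P _ _) (sym (≔r-liftμ s [] M N))
        (Tree-sub (good-liftμ-push g (inj₂ (_ , refl , refl , Tree-weakenμ e))) d)))
      (Tree-mono (m≤n+m b (suc (a * 2))) e))
  Tree-app g d@(app {a = a} o _ _) e =
    app (cut-sub g d (app-neutral-or-cut o)) (Tree-sub g d)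
      (Tree-mono (m≤n+m b (suc a * 2)) e)
  -- The head redex of the operator is that of the whole application, so `N` is applied to the
  -- contractum.
  Tree-app g (head h d q) e = Tree-suc
    (head (happ (Head-sub _ h)) (Tree-app g d e) (Tree-suc (Tree-sub g q)))

open CutReduction using (good-id; Tree-app)

-- Lowering the cut rank

4^a-bound : ∀ a → suc (4 ^ a * 2 + 4 ^ a) ≤ 4 ^ suc a
4^a-bound a = begin
  1 + (4 ^ a * 2 + 4 ^ a)     ≤⟨ +-monoˡ-≤ _ (m^n>0 4 a) ⟩
  4 ^ a + (4 ^ a * 2 + 4 ^ a) ≡⟨ solve 1 (λ x → x :+ (x :* con 2 :+ x) := con 4 :* x) refl (4 ^ a) ⟩
  4 ^ suc a                   ∎
  where open ≤-Reasoning

suc-4^≤ : ∀ a → suc (4 ^ a) ≤ 4 ^ suc a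
suc-4^≤ a = ≤-trans (s≤s (m≤n+m (4 ^ a) (4 ^ a * 2))) (4^a-bound a)

-- A cut whose type has length at most `suc r` has a domain of length at most `r`, so substituting
-- its argument creates only cuts allowed at `r`.
eliminate-cuts : Tree (suc r) Γ Δ M A a → Tree r Γ Δ M A (4 ^ a)
eliminate-cuts (var eq) = var eq
eliminate-cuts {a = suc a} (lam d)      = Tree-mono (suc-4^≤ a) (lam (eliminate-cuts d))
eliminate-cuts {a = suc a} (mu d)       = Tree-mono (suc-4^≤ a) (mu (eliminate-cuts d))
eliminate-cuts {a = suc a} (named eq d) = Tree-mono (suc-4^≤ a) (named eq (eliminate-cuts d))
eliminate-cuts {a = suc a} (app (neutral ν) d e) =
  Tree-mono (suc-4^≤ a) (app (neutral ν) (eliminate-cuts d) (eliminate-cuts e))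
eliminate-cuts {a = suc a} (app {M} {N} {A = A} {B} (cut p) d e) = Tree-mono (4^a-bound a)
  -- The identity substitution lets `Tree-app` absorb just this application; both parts already have
  -- height `4 ^ a`.
  (subst (λ P → Tree _ _ _ (app P N) B _) (sub-id M)
    (Tree-app A≤r (good-id A≤r) (eliminate-cuts d) (eliminate-cuts e)))
  where A≤r = lh-domain {A} {B} p
eliminate-cuts {a = suc a} (head h d e) =
  Tree-mono (suc-4^≤ a) (head h (eliminate-cuts d) (eliminate-cuts e))

-- From typing derivations to the bound

comp>0 : (M : Tm n m) → 0 < comp M
comp>0 (var x)     = s≤s z≤n
comp>0 (lam M)     = m≤n+m 1 (comp M)
comp>0 (mu M)      = m≤n+m 1 (comp M)
comp>0 (named α M) = m≤n+m 1 (comp M)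
comp>0 (app M N)   = ≤-trans (comp>0 M) (m≤m+n _ (comp N))

maximum : List ℕ → ℕ
maximum = foldr _⊔_ 0

maximum-++⁻ˡ : ∀ xs {ys k} → maximum (xs ++ ys) ≤ k → maximum xs ≤ k
maximum-++⁻ˡ []       p = z≤n
maximum-++⁻ˡ (x ∷ xs) p =
  ⊔-lub (m⊔n≤o⇒m≤o x _ p) (maximum-++⁻ˡ xs (m⊔n≤o⇒n≤o x _ p))

maximum-++⁻ʳ : ∀ xs {ys k} → maximum (xs ++ ys) ≤ k → maximum ys ≤ k
maximum-++⁻ʳ []       p = p
maximum-++⁻ʳ (x ∷ xs) p = maximum-++⁻ʳ xs (m⊔n≤o⇒n≤o x _ p)

-- The redexes with an argument in an application spine have decreasing rank
-- towards the root, so the innermost one bounds them all.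
operator-rank : (d : Γ ︔ Δ ⊢ M ∶ A ⇒ B) (e : Γ ︔ Δ ⊢ N ∶ A) →
                rank (⊢app d e) ≤ r → NeutralOrCut r M (A ⇒ B)
operator-rank (⊢var _)   e p = neutral var
operator-rank (⊢lam _)   e p = cut (m⊔n≤o⇒m≤o _ _ p)
operator-rank (⊢mu _)    e p = cut (m⊔n≤o⇒m≤o _ _ p)
operator-rank (⊢app d f) e p = app-neutral-or-cut
  (operator-rank d f (maximum-++⁻ˡ (redexRanks (⊢app d f)) p))

-- The tree copies the derivation. Complexities are positive and add up at an application, so both
-- parts lie strictly below the whole.
typed-Tree : (d : Γ ︔ Δ ⊢ M ∶ A) → rank d ≤ r → comp M ≤ a → Tree r Γ Δ M A a
typed-Tree (⊢var eq) p q = var eq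
typed-Tree {M = lam M} {a = a} (⊢lam d) p q with subst (_≤ a) (+-comm (comp M) 1) q
... | s≤s q′ = lam (typed-Tree d p q′)
typed-Tree {M = mu M} {a = a} (⊢mu d) p q with subst (_≤ a) (+-comm (comp M) 1) q
... | s≤s q′ = mu (typed-Tree d (maximum-++⁻ʳ (rootRank (⊢mu d)) p) q′)
typed-Tree {M = named α M} {a = a} (⊢named eq d) p q with subst (_≤ a) (+-comm (comp M) 1) q
... | s≤s q′ = named eq (typed-Tree d (maximum-++⁻ʳ (rootRank (⊢named eq d)) p) q′)
typed-Tree {M = app M N} {a = zero} (⊢app d e) p q =
  contradiction (≤-trans (comp>0 (app M N)) q) λ ()
typed-Tree {M = app M N} {a = suc a} (⊢app d e) p q = app (operator-rank d e p)
  (typed-Tree d (maximum-++⁻ˡ (redexRanks d) p′)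
    (s≤s⁻¹ (≤-trans (+-monoˡ-≤ (comp M) (comp>0 N))
      (subst (_≤ suc a) (+-comm (comp M) (comp N)) q))))
  (typed-Tree e (maximum-++⁻ʳ (redexRanks d) p′)
    (s≤s⁻¹ (≤-trans (+-monoˡ-≤ (comp N) (comp>0 M)) q)))
  where p′ = maximum-++⁻ʳ (rootRank (⊢app d e)) p

tower₄ : ℕ → ℕ → ℕ
tower₄ zero    a = a
tower₄ (suc k) a = 4 ^ tower₄ k a

eliminate-all-cuts : ∀ k → Tree (k + r) Γ Δ M A a → Tree r Γ Δ M A (tower₄ k a)
eliminate-all-cuts zero d = d
-- The upper `k` levels go first, down to cut rank `suc r`, then the last one.
eliminate-all-cuts {r = r} {Γ = Γ} {Δ = Δ} {M = M} {A = A} {a = a} (suc k) d = eliminate-cuts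
  (eliminate-all-cuts k (subst (λ j → Tree j Γ Δ M A a) (sym (+-suc k r)) d))

tower-mono-< : ∀ k {i j} → i < j → tower k i < tower k j
tower-mono-< zero    p = p
tower-mono-< (suc k) p = ^-monoʳ-< 2 (s≤s (s≤s z≤n)) (tower-mono-< k p)

-- The factor 2 on the left absorbs the base 4 in the induction.
tower₄<tower : ∀ k c → 0 < c → 2 * tower₄ k c < tower k ((2 * k + 3) * c)
tower₄<tower zero    c c>0 = begin-strict
  2 * c     <⟨ m<n+m (2 * c) c>0 ⟩
  c + 2 * c ∎
  where open ≤-Reasoning
tower₄<tower (suc k) c c>0 = begin-strict
  2 * 4 ^ tower₄ k c                ≡⟨ cong (2 *_) (^-*-assoc 2 2 (tower₄ k c)) ⟩
  -- The strict induction hypothesis absorbs the successor; strictness returns in the next step,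
  -- where the coefficient grows by 2.
  2 ^ suc (2 * tower₄ k c)          ≤⟨ ^-monoʳ-≤ 2 (tower₄<tower k c c>0) ⟩
  2 ^ tower k ((2 * k + 3) * c)     <⟨ tower-mono-< (suc k) (*-monoˡ-< c {{>-nonZero c>0}} 2k+3<) ⟩
  tower (suc k) ((2 * suc k + 3) * c) ∎
  where
  open ≤-Reasoning
  2k+3< : 2 * k + 3 < 2 * suc k + 3
  2k+3< = +-monoˡ-< 3 (*-monoʳ-< 2 (n<1+n k))

theorem4p22 : ∀ {n m : ℕ} {Γ : Vec Ty n} {Δ : Vec Ty m} {M : Tm n m} {A : Ty}
    (d : Γ ︔ Δ ⊢ M ∶ A) (k : ℕ) → rank d ≡ k →
    ∀ {N : Tm n m} (rs : M ⟶* N) →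
    length rs < tower (k + 1) ((2 * k + 3) * comp M)
theorem4p22 {M = M} d k refl rs = begin-strict
  length rs                            <⟨ Bounded⇒length< (Tree-Bounded cut-free-tree) rs ⟩
  2 ^ tower₄ k (comp M)                ≤⟨ ^-monoʳ-≤ 2 (m≤m+n (tower₄ k (comp M)) _) ⟩
  2 ^ (2 * tower₄ k (comp M))          ≤⟨ ^-monoʳ-≤ 2 (<⇒≤ (tower₄<tower k (comp M) (comp>0 M))) ⟩
  tower (suc k) ((2 * k + 3) * comp M) ≡⟨ cong (λ j → tower j ((2 * k + 3) * comp M)) (+-comm 1 k) ⟩
  tower (k + 1) ((2 * k + 3) * comp M) ∎
  where
  open ≤-Reasoning
  cut-free-tree : Tree 0 _ _ M _ (tower₄ k (comp M))
  cut-free-tree = eliminate-all-cuts k (typed-Tree d (≤-reflexive (sym (+-identityʳ k))) ≤-refl)
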